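{- For every $B>0$ there is an online algorithm for the online packing problem which, irrevocably assigning each arriving variable $y_i\ge 0$ when it arrives, achieves $\sum_i y_i\ge \mathsf{OPT}/B$ (i.e., it is $1/B$-competitive), changes $y$ (sets some $y_i>0$) in at most $\mathrm{poly}(n,\log B',\log\mathsf{OPT},\log\alpha)$ rounds, and for every packing constraint $j\in[n]$ satisfies $$\sum_{i=1}^m a_{ij}y_i = c_j\cdot O\!\left(\frac{\log n+\log(a^{\max}_j/a^{\min}_j)}{B}\right).$$
   Context: Online packing problem: the LP is $\max \sum_i y_i$ over $y\in\mathbb{R}^m_{\ge 0}$ subject to $A^T y\le c$, where $A=(a_{ij})\in\mathbb{R}^{m\times n}_{\ge0}$ and $c\in\mathbb{R}^n_{>0}$ is known in advance. The variables $y_i$ (columns of $A^T$, i.e. the values $a_{i1},\dots,a_{in}$, at least one positive) arrive one at a time, $m$ possibly unknown; upon arrival $y_i$ is either left at $0$ or irrevocably assigned a positive value. $\mathsf{OPT}$ is the optimal value of the packing LP. $a^{\max}_j=\max_{i\in[m]}a_{ij}$, $a^{\min}_j=\min_{i\in[m]}\{a_{ij}:a_{ij}>0\}$, $\alpha=\max_{j\in[n]}a^{\max}_j/c_j$, and $B'=3\max_{j\in[n]}\ln(2na^{\max}_j/a^{\min}_j+1)$.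
   Formalization: In the load bound, log n is read as log max(n,2); this matters only for n = 1, where the bound as written fails (for n = m = 1 it is 0, while competitiveness forces a positive load). -}

module Defs where

open import Level using (0ℓ)
open import Data.Nat.Base as ℕ using (ℕ)
open import Data.Fin.Base using (Fin)
open import Data.List.Base using (List; []; _∷_)
open import Data.Vec.Base using (Vec; []; _∷_; lookup; count)
open import Data.Product using (∃; ∃₂; _×_)
open import Function.Base using (id)
open import Algebra.Bundles using (CommutativeRing)
open import Algebra.Structures using (IsCommutativeRing)
open import Relation.Binary.Core using (Rel)
open import Relation.Binary.Structures using (IsStrictTotalOrder)
open import Relation.Binary.PropositionalEquality using (_≡_; _≢_)
import Algebra.Definitions.RawMonoid as RawMonoidDefinitions
import Relation.Binary.Construct.StrictToNonStrict as StrictToNonStrict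
import Tactic.RingSolver.Core.Expression as Expression

-- The real numbers, axiomatised classically as a complete ordered field,
-- together with exp and ln.  A complete ordered field is unique up to unique
-- isomorphism, and the conditions below determine exp uniquely and ln
-- uniquely on the positive elements.  The values 0# ⁻¹ and ln x for x ≤ 0#
-- are unspecified.
record Reals : Set₁ where
  infix  4 _<_
  infix  8 -_
  infix  9 _⁻¹
  infixl 7 _*_ _/_
  infixl 6 _+_
  field
    ℝ       : Set
    _<_     : Rel ℝ 0ℓ
    _+_ _*_ : ℝ → ℝ → ℝ
    -_ _⁻¹  : ℝ → ℝ
    0# 1#   : ℝ
    exp ln  : ℝ → ℝ

  open StrictToNonStrict _≡_ _<_ public using (_≤_)

  UpperBound : (ℝ → Set) → ℝ → Set
  UpperBound S u = ∀ x → S x → x ≤ u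

  LowerBound : (ℝ → Set) → ℝ → Set
  LowerBound S l = ∀ x → S x → l ≤ x

  IsLeast : (ℝ → Set) → ℝ → Set
  IsLeast S x = S x × LowerBound S x

  IsGreatest : (ℝ → Set) → ℝ → Set
  IsGreatest S x = S x × UpperBound S x

  field
    isCommutativeRing  : IsCommutativeRing _≡_ _+_ _*_ -_ 0# 1#
    isStrictTotalOrder : IsStrictTotalOrder _≡_ _<_
    0<1                : 0# < 1#
    +-monoʳ-<          : ∀ x {y z} → y < z → x + y < x + z
    *-pos              : ∀ {x y} → 0# < x → 0# < y → 0# < x * y
    *-inverseʳ         : ∀ {x} → x ≢ 0# → x * x ⁻¹ ≡ 1#
    complete           : (S : ℝ → Set) → ∃ S → ∃ (UpperBound S) →
                         ∃ (IsLeast (UpperBound S))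
    exp-+              : ∀ x y → exp (x + y) ≡ exp x * exp y
    1+x≤exp            : ∀ x → 1# + x ≤ exp x
    ln-exp             : ∀ x → ln (exp x) ≡ x
    exp-ln             : ∀ {x} → 0# < x → exp (ln x) ≡ x

  commutativeRing : CommutativeRing 0ℓ 0ℓ
  commutativeRing = record { isCommutativeRing = isCommutativeRing }

  open CommutativeRing commutativeRing public
    using (rawRing; +-rawMonoid)
  open IsStrictTotalOrder isStrictTotalOrder public
    using (_<?_)
  open RawMonoidDefinitions +-rawMonoid public
    using (sum)

  _/_ : ℝ → ℝ → ℝ
  x / y = x * y ⁻¹

  fromℕ : ℕ → ℝ
  fromℕ n = n · 1#
    where open RawMonoidDefinitions +-rawMonoid renaming (_×_ to _·_)

  Polynomial : ℕ → Set
  Polynomial k = Expression.Expr ℝ k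

  evaluate : ∀ {k} → Polynomial k → Vec ℝ k → ℝ
  evaluate = ⟦_⟧
    where open Expression.Eval rawRing id

module Packing (R : Reals) where
  open Reals R

  -- The i-th row of A consists of the coefficients a i 1 , … , a i n of the
  -- variable y i, that is, the i-th column of Aᵀ.
  Matrix : ℕ → ℕ → Set
  Matrix m n = Vec (Vec ℝ n) m

  entry : ∀ {m n} → Matrix m n → Fin m → Fin n → ℝ
  entry A i j = lookup (lookup A i) j

  IsPackingMatrix : ∀ {m n} → Matrix m n → Set
  IsPackingMatrix A =
    (∀ i j → 0# ≤ entry A i j) × (∀ i → ∃ λ j → 0# < entry A i j)

  module _ {m n : ℕ} (A : Matrix m n) where

    total : Vec ℝ m → ℝ
    total y = sum (λ i → lookup y i)

    load : Vec ℝ m → Fin n → ℝ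
    load y j = sum (λ i → entry A i j * lookup y i)

    IsFeasible : Vec ℝ n → Vec ℝ m → Set
    IsFeasible c y = (∀ i → 0# ≤ lookup y i) × (∀ j → load y j ≤ lookup c j)

    IsOPT : Vec ℝ n → ℝ → Set
    IsOPT c = IsGreatest λ v → ∃ λ y → IsFeasible c y × v ≡ total y

    IsMaxEntry : Fin n → ℝ → Set
    IsMaxEntry j = IsGreatest λ v → ∃ λ i → v ≡ entry A i j

    -- No value satisfies this when no entry a i j is positive.
    IsMinPositiveEntry : Fin n → ℝ → Set
    IsMinPositiveEntry j = IsLeast λ v → (∃ λ i → v ≡ entry A i j) × 0# < v

    IsAlpha : Vec ℝ n → ℝ → Set
    IsAlpha c = IsGreatest λ v → ∃₂ λ j aᵐᵃˣ →
      IsMaxEntry j aᵐᵃˣ × v ≡ aᵐᵃˣ / lookup c j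

    -- The maximum ranges over the constraints j having some a i j > 0, the
    -- others having no minimal positive entry.
    IsMaxLogRatio : ℝ → Set
    IsMaxLogRatio = IsGreatest λ v → ∃ λ j → ∃₂ λ aᵐᵃˣ aᵐⁱⁿ →
      IsMaxEntry j aᵐᵃˣ × IsMinPositiveEntry j aᵐⁱⁿ ×
      v ≡ ln (fromℕ 2 * fromℕ n * aᵐᵃˣ / aᵐⁱⁿ + 1#)

    IsB′ : ℝ → Set
    IsB′ B′ = ∃ λ v → IsMaxLogRatio v × B′ ≡ fromℕ 3 * v

  -- The value given to the arriving variable depends only on the rows that
  -- arrived earlier (most recent first) and on the arriving row; the values
  -- given earlier are themselves determined by the earlier rows.
  OnlineAlgorithm : ℕ → Set
  OnlineAlgorithm n = List (Vec ℝ n) → Vec ℝ n → ℝ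

  runFrom : ∀ {m n} → OnlineAlgorithm n → List (Vec ℝ n) → Matrix m n → Vec ℝ m
  runFrom alg past []      = []
  runFrom alg past (r ∷ A) = alg past r ∷ runFrom alg (r ∷ past) A

  run : ∀ {m n} → OnlineAlgorithm n → Matrix m n → Vec ℝ m
  run alg A = runFrom alg [] A

  changes : ∀ {m} → Vec ℝ m → ℕ
  changes y = count (0# <?_) y

{-# OPTIONS --safe #-}
module Submission where

-- Write b j = a j / c j for an arriving row a.  Keep a dual solution w, measured
-- in units of c, and while Σ b j * w j < 1 raise the arriving variable by
-- 1 / Σ b j and each w j by a fraction t j = b j / Σ b j of itself plus
-- 1 / (n * Σ b j).  A raise costs Σ w at most twice its gain in Σ y, so weak duality
-- gives competitiveness.  For M ≥ max b j, it multiplies 1 + n * M * w j by at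
-- least 1 + t j ≥ exp (t j / 2), so this quantity bounds exp (L j / 2), with L j
-- the relative load of constraint j.  Since w j < 1 / b j before a raise, L j is
-- logarithmic in n * max / min.  Since Σ t j = 1, the number of raises is Σ L j;
-- with M = α and w j ≤ Σ w ≤ 2 Σ y = O(B′ * OPT) it is O(n * log (n * α * B′ * OPT)),
-- with no dependence on the ratios beyond B′.

open import Defs
open import Level using (0ℓ)
open import Data.Nat.Base as ℕ using (ℕ; zero; suc; _⊔_)
open import Data.Fin.Base using (Fin; zero; suc)
open import Data.List.Base using (List; []; _∷_)
open import Data.Vec.Base as Vec using (Vec; []; _∷_; lookup; count)
open import Data.Nat.Properties using (m≤m⊔n; m≤n⊔m)
open import Data.Product using (Σ; ∃; _×_; _,_; proj₁; proj₂)
open import Data.Sum.Base using (_⊎_; inj₁; inj₂)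
open import Algebra.Bundles using (CommutativeRing)
open import Data.Vec.Properties using (lookup-map)
open import Relation.Binary.Bundles using (StrictPartialOrder)
open import Relation.Binary.Definitions using (tri<; tri≈; tri>)
open import Relation.Binary.Structures using (IsStrictTotalOrder)
open import Relation.Binary.PropositionalEquality
  using (_≡_; refl; sym; trans; cong; cong₂; subst; subst₂)
open import Tactic.RingSolver.Core.Expression using (Κ; Ι; _⊕_; _⊗_)
open import Relation.Nullary using (¬_; Dec; yes; no; contradiction)

-- Arithmetic of ordered fields.

module RealProperties (R : Reals) where
  open Reals R
  open CommutativeRing commutativeRing
    using ( +-assoc; +-comm; +-identityˡ; +-identityʳ; *-assoc; *-comm; *-identityˡ; *-identityʳ
          ; distribˡ; distribʳ; zeroˡ; zeroʳ; -‿inverseˡ; -‿inverseʳ; commutativeSemiring; semiring)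
    public
  open IsStrictTotalOrder isStrictTotalOrder
    using (compare; irrefl; asym; isStrictPartialOrder) public
  open import Algebra.Solver.Ring.NaturalCoefficients.Default commutativeSemiring
    using (solve; _:=_; _:+_; _:*_; con) public
  open import Algebra.Properties.Semiring.Sum semiring
    using (sum-cong-≗; ∑-distrib-+; ∑-comm; *-distribˡ-sum; *-distribʳ-sum) public

  strictPartialOrder : StrictPartialOrder 0ℓ 0ℓ 0ℓ
  strictPartialOrder = record { isStrictPartialOrder = isStrictPartialOrder }

  open import Relation.Binary.Reasoning.StrictPartialOrder strictPartialOrder public

  2# : ℝ
  2# = 1# + 1#

  ≤-refl : ∀ {x} → x ≤ x
  ≤-refl = inj₂ refl

  ≤-trans : ∀ {x y z} → x ≤ y → y ≤ z → x ≤ z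
  ≤-trans {x} {y} {z} x≤y y≤z = begin x ≤⟨ x≤y ⟩ y ≤⟨ y≤z ⟩ z ∎

  <⇒≱ : ∀ {x y} → x < y → ¬ y ≤ x
  <⇒≱ x<y (inj₁ y<x) = asym x<y y<x
  <⇒≱ x<y (inj₂ refl) = irrefl refl x<y

  ≮⇒≥ : ∀ {x y} → ¬ x < y → y ≤ x
  ≮⇒≥ {x} {y} x≮y with compare x y
  ... | tri< x<y _ _ = contradiction x<y x≮y
  ... | tri≈ _ x≡y _ = inj₂ (sym x≡y)
  ... | tri> _ _ y<x = inj₁ y<x

  +-monoʳ-≤ : ∀ x {y z} → y ≤ z → x + y ≤ x + z
  +-monoʳ-≤ x (inj₁ y<z) = inj₁ (+-monoʳ-< x y<z)
  +-monoʳ-≤ x (inj₂ y≡z) = inj₂ (cong (x +_) y≡z)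

  +-monoˡ-≤ : ∀ x {y z} → y ≤ z → y + x ≤ z + x
  +-monoˡ-≤ x {y} {z} y≤z = subst₂ _≤_ (+-comm x y) (+-comm x z) (+-monoʳ-≤ x y≤z)

  +-mono-≤ : ∀ {x y u v} → x ≤ y → u ≤ v → x + u ≤ y + v
  +-mono-≤ {y = y} {u} x≤y u≤v = ≤-trans (+-monoˡ-≤ u x≤y) (+-monoʳ-≤ y u≤v)

  x≤x+y : ∀ {x y} → 0# ≤ y → x ≤ x + y
  x≤x+y {x} {y} 0≤y = subst (_≤ x + y) (+-identityʳ x) (+-monoʳ-≤ x 0≤y)

  x≤y+x : ∀ {x y} → 0# ≤ y → x ≤ y + x
  x≤y+x {x} {y} 0≤y = subst (x ≤_) (+-comm x y) (x≤x+y 0≤y)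

  +-nonNeg : ∀ {x y} → 0# ≤ x → 0# ≤ y → 0# ≤ x + y
  +-nonNeg 0≤x 0≤y = ≤-trans 0≤x (x≤x+y 0≤y)

  +-cancelˡ-≤ : ∀ x {y z} → x + y ≤ x + z → y ≤ z
  +-cancelˡ-≤ x le = ≮⇒≥ λ z<y → <⇒≱ (+-monoʳ-< x z<y) le

  0≤1 : 0# ≤ 1#
  0≤1 = inj₁ 0<1

  0≤2 : 0# ≤ 2#
  0≤2 = +-nonNeg 0≤1 0≤1

  x+[y-x]≡y : ∀ x y → x + (y + - x) ≡ y
  x+[y-x]≡y x y = begin-equality
    x + (y + - x) ≡⟨ solve 3 (λ x y z → x :+ (y :+ z) := y :+ (x :+ z)) refl x y (- x) ⟩
    y + (x + - x) ≡⟨ cong (y +_) (-‿inverseʳ x) ⟩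
    y + 0#        ≡⟨ +-identityʳ y ⟩
    y             ∎

  x<y⇒0<y-x : ∀ {x y} → x < y → 0# < y + - x
  x<y⇒0<y-x {x} {y} x<y =
    subst₂ _<_ (-‿inverseˡ x) (+-comm (- x) y) (+-monoʳ-< (- x) x<y)

  *-monoʳ-< : ∀ {x y z} → 0# < x → y < z → x * y < x * z
  *-monoʳ-< {x} {y} {z} 0<x y<z = begin-strict
    x * y                       ≡⟨ +-identityʳ (x * y) ⟨
    x * y + 0#                  <⟨ +-monoʳ-< (x * y) (*-pos 0<x (x<y⇒0<y-x y<z)) ⟩
    x * y + x * (z + - y)       ≡⟨ distribˡ x y (z + - y) ⟨
    x * (y + (z + - y))         ≡⟨ cong (x *_) (x+[y-x]≡y y z) ⟩
    x * z                       ∎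

  *-monoʳ-≤ : ∀ {x y z} → 0# ≤ x → y ≤ z → x * y ≤ x * z
  *-monoʳ-≤ (inj₁ 0<x) (inj₁ y<z) = inj₁ (*-monoʳ-< 0<x y<z)
  *-monoʳ-≤ {x} _ (inj₂ refl) = ≤-refl
  *-monoʳ-≤ {y = y} {z} (inj₂ refl) (inj₁ _) = inj₂ (trans (zeroˡ y) (sym (zeroˡ z)))

  *-monoˡ-≤ : ∀ {x y z} → 0# ≤ x → y ≤ z → y * x ≤ z * x
  *-monoˡ-≤ {x} {y} {z} 0≤x y≤z = subst₂ _≤_ (*-comm x y) (*-comm x z) (*-monoʳ-≤ 0≤x y≤z)

  *-nonNeg : ∀ {x y} → 0# ≤ x → 0# ≤ y → 0# ≤ x * y
  *-nonNeg {x} {y} 0≤x 0≤y = subst (_≤ x * y) (zeroʳ x) (*-monoʳ-≤ 0≤x 0≤y)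

  *-mono-≤ : ∀ {x y u v} → 0# ≤ u → 0# ≤ y → x ≤ y → u ≤ v → x * u ≤ y * v
  *-mono-≤ 0≤u 0≤y x≤y u≤v = ≤-trans (*-monoˡ-≤ 0≤u x≤y) (*-monoʳ-≤ 0≤y u≤v)

  *-cancelˡ-≤ : ∀ {x y z} → 0# < x → x * y ≤ x * z → y ≤ z
  *-cancelˡ-≤ 0<x le = ≮⇒≥ λ z<y → <⇒≱ (*-monoʳ-< 0<x z<y) le

  *-cancelˡ-pos : ∀ {x y} → 0# < x → 0# < x * y → 0# < y
  *-cancelˡ-pos {x} {y} 0<x 0<xy with 0# <? y
  ... | yes 0<y = 0<y
  ... | no 0≮y = contradiction (*-monoʳ-≤ (inj₁ 0<x) (≮⇒≥ 0≮y))
                   (<⇒≱ (subst (_< x * y) (sym (zeroʳ x)) 0<xy))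

  x≤y⇒x≤zy : ∀ {y z} → 0# ≤ y → 1# ≤ z → y ≤ z * y
  x≤y⇒x≤zy {y} {z} 0≤y 1≤z = subst (_≤ z * y) (*-identityˡ y) (*-monoˡ-≤ 0≤y 1≤z)

  *-inverse-pos : ∀ {x} → 0# < x → x * x ⁻¹ ≡ 1#
  *-inverse-pos 0<x = *-inverseʳ λ { refl → irrefl refl 0<x }

  ⁻¹-pos : ∀ {x} → 0# < x → 0# < x ⁻¹
  ⁻¹-pos 0<x = *-cancelˡ-pos 0<x (subst (0# <_) (sym (*-inverse-pos 0<x)) 0<1)

  x*[y/x]≡y : ∀ {x} y → 0# < x → x * (y / x) ≡ y
  x*[y/x]≡y {x} y 0<x = begin-equality
    x * (y * x ⁻¹) ≡⟨ solve 3 (λ x y z → x :* (y :* z) := y :* (x :* z)) refl x y (x ⁻¹) ⟩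
    y * (x * x ⁻¹) ≡⟨ cong (y *_) (*-inverse-pos 0<x) ⟩
    y * 1#         ≡⟨ *-identityʳ y ⟩
    y              ∎

  /-pos : ∀ {x y} → 0# < x → 0# < y → 0# < x / y
  /-pos 0<x 0<y = *-pos 0<x (⁻¹-pos 0<y)

  /-nonNeg : ∀ {x y} → 0# ≤ x → 0# < y → 0# ≤ x / y
  /-nonNeg 0≤x 0<y = *-nonNeg 0≤x (inj₁ (⁻¹-pos 0<y))

  0<2 : 0# < 2#
  0<2 = begin-strict 0# <⟨ 0<1 ⟩ 1# ≤⟨ x≤x+y 0≤1 ⟩ 2# ∎

  ½ : ℝ
  ½ = 2# ⁻¹

  ½x+½x≡x : ∀ x → ½ * x + ½ * x ≡ x
  ½x+½x≡x x = begin-equality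
    ½ * x + ½ * x ≡⟨ solve 2 (λ h x → h :* x :+ h :* x := (con 2 :* h) :* x) refl ½ x ⟩
    (2# * ½) * x  ≡⟨ cong (_* x) (*-inverse-pos 0<2) ⟩
    1# * x        ≡⟨ *-identityˡ x ⟩
    x             ∎

  ½x≤y⇒x≤y+y : ∀ {x y} → ½ * x ≤ y → x ≤ y + y
  ½x≤y⇒x≤y+y {x} {y} ½x≤y = subst (_≤ y + y) (½x+½x≡x x) (+-mono-≤ ½x≤y ½x≤y)

  square-nonNeg : ∀ x → 0# ≤ x * x
  square-nonNeg x with x <? 0#
  ... | no x≮0 = *-nonNeg (≮⇒≥ x≮0) (≮⇒≥ x≮0)
  ... | yes x<0 = subst (0# ≤_) (sym square) (*-nonNeg 0≤y 0≤y)
    where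
    y : ℝ
    y = 0# + - x
    0≤y : 0# ≤ y
    0≤y = inj₁ (x<y⇒0<y-x x<0)
    x+y≡0 : x + y ≡ 0#
    x+y≡0 = x+[y-x]≡y x 0#
    square : x * x ≡ y * y
    -- Inserting the vanishing `x + y` trades `x * x` for `y * y` by semiring identities alone.
    square = begin-equality
      x * x                  ≡⟨ +-identityʳ (x * x) ⟨
      x * x + 0#             ≡⟨ cong (x * x +_) (zeroˡ y) ⟨
      x * x + 0# * y         ≡⟨ cong (λ z → x * x + z * y) x+y≡0 ⟨
      x * x + (x + y) * y    ≡⟨ solve 2 (λ x y → x :* x :+ (x :+ y) :* y := x :* (x :+ y) :+ y :* y) refl x y ⟩
      x * (x + y) + y * y    ≡⟨ cong (λ z → x * z + y * y) x+y≡0 ⟩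
      x * 0# + y * y         ≡⟨ cong (_+ y * y) (zeroʳ x) ⟩
      0# + y * y             ≡⟨ +-identityˡ (y * y) ⟩
      y * y                  ∎

  -- Lets a sum of logarithms of unknown sign be replaced by a nonnegative polynomial in it.
  x≤x²+1 : ∀ x → x ≤ x * x + 1#
  x≤x²+1 x with x <? 1#
  ... | no x≮1 = ≤-trans (x≤y⇒x≤zy (≤-trans 0≤1 (≮⇒≥ x≮1)) (≮⇒≥ x≮1)) (x≤x+y 0≤1)
  ... | yes x<1 = ≤-trans (inj₁ x<1) (x≤y+x (square-nonNeg x))

  -- The exponential function.

  exp-0 : exp 0# ≡ 1#
  -- `exp 0#` is a positive idempotent, so multiplying by its inverse cancels one copy.
  exp-0 = begin-equality
    exp 0#                             ≡⟨ *-identityʳ (exp 0#) ⟨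
    exp 0# * 1#                        ≡⟨ cong (exp 0# *_) (*-inverse-pos 0<e) ⟨
    exp 0# * (exp 0# * exp 0# ⁻¹)      ≡⟨ *-assoc (exp 0#) (exp 0#) (exp 0# ⁻¹) ⟨
    exp 0# * exp 0# * exp 0# ⁻¹        ≡⟨ cong (_* exp 0# ⁻¹) (exp-+ 0# 0#) ⟨
    exp (0# + 0#) * exp 0# ⁻¹          ≡⟨ cong (λ x → exp x * exp 0# ⁻¹) (+-identityˡ 0#) ⟩
    exp 0# * exp 0# ⁻¹                 ≡⟨ *-inverse-pos 0<e ⟩
    1#                                 ∎
    where
    0<e : 0# < exp 0#
    0<e = begin-strict 0# <⟨ 0<1 ⟩ 1# ≡⟨ +-identityʳ 1# ⟨ 1# + 0# ≤⟨ 1+x≤exp 0# ⟩ exp 0# ∎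

  exp-neg : ∀ x → exp x * exp (- x) ≡ 1#
  exp-neg x = trans (sym (exp-+ x (- x))) (trans (cong exp (-‿inverseʳ x)) exp-0)

  0≤x⇒0<exp : ∀ {x} → 0# ≤ x → 0# < exp x
  0≤x⇒0<exp {x} 0≤x = begin-strict 0# <⟨ 0<1 ⟩ 1# ≤⟨ x≤x+y 0≤x ⟩ 1# + x ≤⟨ 1+x≤exp x ⟩ exp x ∎

  -- For negative `x`, the value at `- x` is positive by `1+x≤exp`, and `exp-neg` passes positivity
  -- on to the reciprocal.
  0<exp : ∀ x → 0# < exp x
  0<exp x with x <? 0#
  ... | no x≮0 = 0≤x⇒0<exp (≮⇒≥ x≮0)
  ... | yes x<0 = *-cancelˡ-pos (0≤x⇒0<exp (inj₁ 0<-x)) (subst (0# <_) (trans (sym (exp-neg x)) (*-comm _ _)) 0<1)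
    where
    0<-x : 0# < - x
    0<-x = subst (0# <_) (+-identityˡ (- x)) (x<y⇒0<y-x x<0)

  -- Strictness comes from `1 < 1 + (y - x) ≤ exp (y - x)`, multiplied by the positive `exp x`.
  exp-mono-< : ∀ {x y} → x < y → exp x < exp y
  exp-mono-< {x} {y} x<y = begin-strict
    exp x                     ≡⟨ *-identityʳ (exp x) ⟨
    exp x * 1#                ≡⟨ cong (exp x *_) (+-identityʳ 1#) ⟨
    exp x * (1# + 0#)         <⟨ *-monoʳ-< (0<exp x) (+-monoʳ-< 1# (x<y⇒0<y-x x<y)) ⟩
    exp x * (1# + (y + - x))  ≤⟨ *-monoʳ-≤ (inj₁ (0<exp x)) (1+x≤exp (y + - x)) ⟩
    exp x * exp (y + - x)     ≡⟨ exp-+ x (y + - x) ⟨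
    exp (x + (y + - x))       ≡⟨ cong exp (x+[y-x]≡y x y) ⟩
    exp y                     ∎

  exp-mono-≤ : ∀ {x y} → x ≤ y → exp x ≤ exp y
  exp-mono-≤ (inj₁ x<y) = inj₁ (exp-mono-< x<y)
  exp-mono-≤ (inj₂ refl) = ≤-refl

  exp-cancel-≤ : ∀ {x y} → exp x ≤ exp y → x ≤ y
  exp-cancel-≤ le = ≮⇒≥ λ y<x → <⇒≱ (exp-mono-< y<x) le

  1≤exp : ∀ {x} → 0# ≤ x → 1# ≤ exp x
  1≤exp {x} 0≤x = ≤-trans (x≤x+y 0≤x) (1+x≤exp x)

  -- With `s = t / 2`, the bound `1 - s ≤ exp (- s)` gives `exp s * (1 - s) ≤ 1`, and
  -- `(1 - s) * (1 + t) = 1 + s * (1 - t)` is at least 1 because `t ≤ 1`.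
  exp-½ : ∀ {t} → 0# ≤ t → t ≤ 1# → exp (½ * t) ≤ 1# + t
  exp-½ {t} 0≤t t≤1 = begin
    exp s                                 ≡⟨ *-identityʳ (exp s) ⟨
    exp s * 1#                            ≤⟨ *-monoʳ-≤ (inj₁ (0<exp s)) 1≤ ⟩
    exp s * ((1# + - s) * (1# + t))       ≤⟨ *-monoʳ-≤ (inj₁ (0<exp s)) (*-monoˡ-≤ (+-nonNeg 0≤1 0≤t) (1+x≤exp (- s))) ⟩
    exp s * (exp (- s) * (1# + t))        ≡⟨ *-assoc _ _ _ ⟨
    exp s * exp (- s) * (1# + t)          ≡⟨ cong (_* (1# + t)) (exp-neg s) ⟩
    1# * (1# + t)                         ≡⟨ *-identityˡ (1# + t) ⟩
    1# + t                                ∎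
    where
    s : ℝ
    s = ½ * t
    0≤s : 0# ≤ s
    0≤s = *-nonNeg (inj₁ (⁻¹-pos 0<2)) 0≤t
    1≤ : 1# ≤ (1# + - s) * (1# + t)
    -- Adding `s * t` to both sides and inserting the vanishing `s + - s` leaves only semiring
    -- identities, apart from `s + s = t`.
    1≤ = +-cancelˡ-≤ (s * t) (begin
      s * t + 1#                           ≤⟨ +-monoˡ-≤ 1# (*-monoʳ-≤ 0≤s t≤1) ⟩
      s * 1# + 1#                          ≡⟨ +-identityʳ _ ⟨
      s * 1# + 1# + 0#                     ≡⟨ cong (s * 1# + 1# +_) (zeroˡ (1# + t)) ⟨
      s * 1# + 1# + 0# * (1# + t)          ≡⟨ cong (λ z → s * 1# + 1# + z * (1# + t)) (-‿inverseʳ s) ⟨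
      s * 1# + 1# + (s + - s) * (1# + t)   ≡⟨ solve 3 (λ s n t → s :* con 1 :+ con 1 :+ (s :+ n) :* (con 1 :+ t)
                                                  := (s :+ s) :+ (con 1 :+ s :* t :+ n :* (con 1 :+ t))) refl s (- s) t ⟩
      (s + s) + (1# + s * t + - s * (1# + t)) ≡⟨ cong (_+ (1# + s * t + - s * (1# + t))) (½x+½x≡x t) ⟩
      t + (1# + s * t + - s * (1# + t))    ≡⟨ solve 3 (λ s n t → t :+ (con 1 :+ s :* t :+ n :* (con 1 :+ t))
                                                  := s :* t :+ (con 1 :+ n) :* (con 1 :+ t)) refl s (- s) t ⟩
      s * t + (1# + - s) * (1# + t)        ∎)

  -- Natural multiples, finite sums and extremal indices.

  fromℕ-nonNeg : ∀ n → 0# ≤ fromℕ n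
  fromℕ-nonNeg zero = ≤-refl
  fromℕ-nonNeg (suc n) = +-nonNeg 0≤1 (fromℕ-nonNeg n)

  1≤fromℕ-suc : ∀ n → 1# ≤ fromℕ (suc n)
  1≤fromℕ-suc n = x≤x+y (fromℕ-nonNeg n)

  Fin⇒1≤fromℕ : ∀ {n} → Fin n → 1# ≤ fromℕ n
  Fin⇒1≤fromℕ {suc n} _ = 1≤fromℕ-suc n

  fromℕ-mono-≤ : ∀ {m n} → m ℕ.≤ n → fromℕ m ≤ fromℕ n
  fromℕ-mono-≤ {n = n} ℕ.z≤n = fromℕ-nonNeg n
  fromℕ-mono-≤ (ℕ.s≤s m≤n) = +-monoʳ-≤ 1# (fromℕ-mono-≤ m≤n)

  fromℕ-2 : fromℕ 2 ≡ 2#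
  fromℕ-2 = cong (1# +_) (+-identityʳ 1#)

  fromℕ-3 : fromℕ 3 ≡ 1# + 2#
  fromℕ-3 = cong (1# +_) fromℕ-2

  sum-const : ∀ n x → sum {n} (λ _ → x) ≡ fromℕ n * x
  sum-const zero x = sym (zeroˡ x)
  sum-const (suc n) x = trans (cong₂ _+_ (sym (*-identityˡ x)) (sum-const n x)) (sym (distribʳ x 1# (fromℕ n)))

  sum-mono-≤ : ∀ {n} {f g : Fin n → ℝ} → (∀ i → f i ≤ g i) → sum f ≤ sum g
  sum-mono-≤ {zero} f≤g = ≤-refl
  sum-mono-≤ {suc n} f≤g = +-mono-≤ (f≤g zero) (sum-mono-≤ λ i → f≤g (suc i))

  sum-nonNeg : ∀ {n} {f : Fin n → ℝ} → (∀ i → 0# ≤ f i) → 0# ≤ sum f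
  sum-nonNeg {zero} 0≤f = ≤-refl
  sum-nonNeg {suc n} 0≤f = +-nonNeg (0≤f zero) (sum-nonNeg λ i → 0≤f (suc i))

  term≤sum : ∀ {n} {f : Fin n → ℝ} → (∀ i → 0# ≤ f i) → ∀ i → f i ≤ sum f
  term≤sum 0≤f zero = x≤x+y (sum-nonNeg λ i → 0≤f (suc i))
  term≤sum 0≤f (suc i) = ≤-trans (term≤sum (λ i → 0≤f (suc i)) i) (x≤y+x (0≤f zero))

  -- Meant for `f i` equal to the mass of row `i` times its value, which is at least 1 whenever that
  -- variable is raised.
  count≤sum : ∀ {m} (y : Vec ℝ m) (f : Fin m → ℝ) → (∀ i → 0# ≤ f i) →
              (∀ i → 0# < lookup y i → 1# ≤ f i) → fromℕ (count (0# <?_) y) ≤ sum f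
  count≤sum [] f 0≤f 1≤f = ≤-refl
  count≤sum (x ∷ y) f 0≤f 1≤f with 0# <? x
  ... | yes 0<x = +-mono-≤ (1≤f zero 0<x) (count≤sum y _ (λ i → 0≤f (suc i)) (λ i → 1≤f (suc i)))
  ... | no _ = ≤-trans (count≤sum y _ (λ i → 0≤f (suc i)) (λ i → 1≤f (suc i))) (x≤y+x (0≤f zero))

  max-index : ∀ {m} → Fin m → (f : Fin m → ℝ) → ∃ λ i → ∀ k → f k ≤ f i
  max-index {suc zero} _ f = zero , λ { zero → ≤-refl }
  max-index {suc (suc m)} _ f with max-index zero (λ i → f (suc i))
  ... | i , f≤ with f (suc i) <? f zero
  ...   | yes i<0 = zero , λ { zero → ≤-refl ; (suc k) → ≤-trans (f≤ k) (inj₁ i<0) }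
  ...   | no i≮0 = suc i , λ { zero → ≮⇒≥ i≮0 ; (suc k) → f≤ k }

  min-positive-index : ∀ {m} (f : Fin m → ℝ) →
    (∀ i → ¬ 0# < f i) ⊎ (∃ λ i → 0# < f i × (∀ k → 0# < f k → f i ≤ f k))
  min-positive-index {zero} f = inj₁ λ ()
  min-positive-index {suc m} f with 0# <? f zero | min-positive-index (λ i → f (suc i))
  ... | no 0≮ | inj₁ none = inj₁ λ { zero → 0≮ ; (suc k) → none k }
  ... | yes 0< | inj₁ none =
    inj₂ (zero , 0< , λ { zero _ → ≤-refl ; (suc k) 0<k → contradiction 0<k (none k) })
  ... | no 0≮ | inj₂ (i , 0<i , ≤f) =
    inj₂ (suc i , 0<i , λ { zero 0<0 → contradiction 0<0 0≮ ; (suc k) → ≤f k })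
  ... | yes 0< | inj₂ (i , 0<i , ≤f) with f (suc i) <? f zero
  ...   | yes i<0 = inj₂ (suc i , 0<i , λ { zero _ → inj₁ i<0 ; (suc k) → ≤f k })
  ...   | no i≮0 = inj₂ (zero , 0< , λ { zero _ → ≤-refl ; (suc k) 0<k → ≤-trans (≮⇒≥ i≮0) (≤f k 0<k) })

-- Scaled solutions and the existence of extremal entries.

module PackingProperties (R : Reals) where
  open Reals R
  open Packing R
  open RealProperties R

  module _ {m n : ℕ} (A : Matrix m n) where

    total-map-* : ∀ s y → total A (Vec.map (s *_) y) ≡ s * total A y
    total-map-* s y = trans (sum-cong-≗ λ i → lookup-map i (s *_) y) (sym (*-distribˡ-sum s (lookup y)))

    load-map-* : ∀ s y j → load A (Vec.map (s *_) y) j ≡ s * load A y j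
    load-map-* s y j = trans (sum-cong-≗ term) (sym (*-distribˡ-sum s (λ i → entry A i j * lookup y i)))
      where
      term : ∀ i → entry A i j * lookup (Vec.map (s *_) y) i ≡ s * (entry A i j * lookup y i)
      term i = trans (cong (entry A i j *_) (lookup-map i (s *_) y))
        (solve 3 (λ a s y → a :* (s :* y) := s :* (a :* y)) refl (entry A i j) s (lookup y i))

    maxEntry : Fin m → ∀ j → ∃ λ v → IsMaxEntry A j v
    maxEntry i₀ j with max-index i₀ (λ i → entry A i j)
    ... | i , ≤i = entry A i j , (i , refl) , λ { _ (k , refl) → ≤i k }

    minPositiveEntry : ∀ j → (∀ i → ¬ 0# < entry A i j) ⊎ (∃ λ v → IsMinPositiveEntry A j v)
    minPositiveEntry j with min-positive-index (λ i → entry A i j)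
    ... | inj₁ none = inj₁ none
    ... | inj₂ (i , 0<i , i≤) = inj₂ (entry A i j , ((i , refl) , 0<i) , λ { _ ((k , refl) , 0<k) → i≤ k 0<k })

  -- Decisions read the earlier rows and not the earlier values, so scaling the output leaves every
  -- decision as it was.
  run-map-* : ∀ {m n} s (f : OnlineAlgorithm n) past (A : Matrix m n) →
    runFrom (λ past r → s * f past r) past A ≡ Vec.map (s *_) (runFrom f past A)
  run-map-* s f past [] = refl
  run-map-* s f past (r ∷ A) = cong (s * f past r ∷_) (run-map-* s f (r ∷ past) A)

-- The multiplicative-weights algorithm.

module MultiplicativeWeights (R : Reals) (n : ℕ) (c : Vec (Reals.ℝ R) n)
  (0<c : ∀ j → Reals._<_ R (Reals.0# R) (lookup c j)) where
  open Reals R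
  open Packing R
  open RealProperties R
  open PackingProperties R

  Row Weights : Set
  Row = Vec ℝ n
  Weights = Fin n → ℝ

  density : Row → Fin n → ℝ
  density r j = lookup r j / lookup c j

  mass unit : Row → ℝ
  mass r = sum (density r)
  unit r = mass r ⁻¹

  -- The left side of the dual constraint belonging to the row, for weights in units of `c`; dual
  -- feasibility asks that it be at least 1.
  pressure : Row → Weights → ℝ
  pressure r w = sum λ j → density r j * w j

  -- For `n = 0` this value is unspecified, but an `IsRow` supplies an index and so makes `n`
  -- positive.
  ν : ℝ
  ν = fromℕ n ⁻¹

  raise : Row → Weights → Weights
  raise r w j = w j + unit r * (density r j * w j + ν)

  -- Fuel makes the loop structurally recursive. Counting the raises gives the assigned value as a
  -- whole multiple of `unit r`; the new weights are recovered by `raises`.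
  rounds : ℕ → Row → Weights → ℕ
  rounds zero r w = zero
  rounds (suc fuel) r w with pressure r w <? 1#
  ... | yes _ = suc (rounds fuel r (raise r w))
  ... | no _ = zero

  raises : ℕ → Row → Weights → Weights
  raises zero r w = w
  raises (suc k) r w = raises k r (raise r w)

  -- Each raise adds at least 1 / n to the pressure, so n of them suffice.
  absorb : Row → Weights → Weights
  absorb r w = raises (rounds n r w) r w

  -- An online algorithm is given rows only, so the dual state is replayed from them; the most
  -- recent row heads the list and is absorbed last.
  weights : List Row → Weights
  weights [] j = 0#
  weights (r ∷ past) = absorb r (weights past)

  alg : OnlineAlgorithm n
  alg past r = fromℕ (rounds n r (weights past)) * unit r

  weightsAfter : ∀ {m} → List Row → Matrix m n → Weights
  weightsAfter past [] = weights past
  weightsAfter past (r ∷ A) = weightsAfter (r ∷ past) A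

  record IsRow (r : Row) : Set where
    constructor isRow
    field
      entries-nonNeg : ∀ j → 0# ≤ lookup r j
      positive-entry : ∃ λ j → 0# < lookup r j

  NonNeg : Weights → Set
  NonNeg w = ∀ j → 0# ≤ w j

  -- The effect of one arriving row.

  module _ {r : Row} (row : IsRow r) where
    open IsRow row

    j₀ : Fin n
    j₀ = proj₁ positive-entry

    density-nonNeg : ∀ j → 0# ≤ density r j
    density-nonNeg j = /-nonNeg (entries-nonNeg j) (0<c j)

    mass-pos : 0# < mass r
    mass-pos = begin-strict 0# <⟨ /-pos (proj₂ positive-entry) (0<c j₀) ⟩ density r j₀ ≤⟨ term≤sum density-nonNeg j₀ ⟩ mass r ∎

    mass*unit≡1 : mass r * unit r ≡ 1#
    mass*unit≡1 = *-inverse-pos mass-pos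

    unit-nonNeg : 0# ≤ unit r
    unit-nonNeg = inj₁ (⁻¹-pos mass-pos)

    -- Puts the growth fraction `t j` in the range where `exp-½` applies.
    density*unit≤1 : ∀ j → density r j * unit r ≤ 1#
    density*unit≤1 j = begin
      density r j * unit r ≤⟨ *-monoˡ-≤ unit-nonNeg (term≤sum density-nonNeg j) ⟩
      mass r * unit r      ≡⟨ mass*unit≡1 ⟩
      1#                   ∎

    0<n : 0# < fromℕ n
    0<n = begin-strict 0# <⟨ 0<1 ⟩ 1# ≤⟨ Fin⇒1≤fromℕ j₀ ⟩ fromℕ n ∎

    n*ν≡1 : fromℕ n * ν ≡ 1#
    n*ν≡1 = *-inverse-pos 0<n

    ν-nonNeg : 0# ≤ ν
    ν-nonNeg = inj₁ (⁻¹-pos 0<n)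

    module _ {w : Weights} (0≤w : NonNeg w) where

      pressure-terms-nonNeg : ∀ j → 0# ≤ density r j * w j
      pressure-terms-nonNeg j = *-nonNeg (density-nonNeg j) (0≤w j)

      pressure-nonNeg : 0# ≤ pressure r w
      pressure-nonNeg = sum-nonNeg pressure-terms-nonNeg

      w≤raise : ∀ j → w j ≤ raise r w j
      w≤raise j = x≤x+y (*-nonNeg unit-nonNeg (+-nonNeg (pressure-terms-nonNeg j) ν-nonNeg))

      raise-nonNeg : NonNeg (raise r w)
      raise-nonNeg j = ≤-trans (0≤w j) (w≤raise j)

      -- The `n` additive shares `ν` sum to 1, the multiplicative shares to the pressure.
      sum-raise : sum (raise r w) ≡ sum w + unit r * (pressure r w + 1#)
      sum-raise = begin-equality
        sum (raise r w)                                              ≡⟨ ∑-distrib-+ w _ ⟩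
        sum w + sum (λ j → unit r * (density r j * w j + ν))         ≡⟨ cong (sum w +_) (*-distribˡ-sum (unit r) (λ j → density r j * w j + ν)) ⟨
        sum w + unit r * sum (λ j → density r j * w j + ν)           ≡⟨ cong (λ x → sum w + unit r * x) (∑-distrib-+ (λ j → density r j * w j) (λ _ → ν)) ⟩
        sum w + unit r * (pressure r w + sum {n} (λ _ → ν))          ≡⟨ cong (λ x → sum w + unit r * (pressure r w + x)) (trans (sum-const n ν) n*ν≡1) ⟩
        sum w + unit r * (pressure r w + 1#)                         ∎

      -- The additive shares alone contribute `mass r * unit r * ν = ν`; the multiplicative ones are
      -- nonnegative and are dropped.
      pressure-raise : pressure r w + ν ≤ pressure r (raise r w)
      pressure-raise = begin
        pressure r w + ν                                             ≡⟨ cong (pressure r w +_) (*-identityˡ ν) ⟨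
        pressure r w + 1# * ν                                        ≡⟨ cong (λ x → pressure r w + x * ν) mass*unit≡1 ⟨
        pressure r w + mass r * unit r * ν                           ≡⟨ cong (pressure r w +_) (*-assoc (mass r) (unit r) ν) ⟩
        pressure r w + mass r * (unit r * ν)                         ≡⟨ cong (pressure r w +_) (*-distribʳ-sum (unit r * ν) (density r)) ⟩
        pressure r w + sum (λ j → density r j * (unit r * ν))        ≡⟨ ∑-distrib-+ (λ j → density r j * w j) (λ j → density r j * (unit r * ν)) ⟨
        sum (λ j → density r j * w j + density r j * (unit r * ν))   ≤⟨ sum-mono-≤ term ⟩
        pressure r (raise r w)                                       ∎
        where
        term : ∀ j → density r j * w j + density r j * (unit r * ν) ≤ density r j * raise r w j
        term j = begin
          b * w j + b * (unit r * ν)                             ≤⟨ x≤x+y (*-nonNeg (*-nonNeg (density-nonNeg j) unit-nonNeg) (pressure-terms-nonNeg j)) ⟩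
          b * w j + b * (unit r * ν) + b * unit r * (b * w j)    ≡⟨ solve 4 (λ b w u v → b :* w :+ b :* (u :* v) :+ b :* u :* (b :* w)
                                                                      := b :* (w :+ u :* (b :* w :+ v))) refl b (w j) (unit r) ν ⟩
          b * raise r w j                                        ∎
          where
          b : ℝ
          b = density r j

    -- Each raise trades one `ν` of fuel for at least one `ν` of pressure, so their sum stays at
    -- least 1; once the fuel is spent, the pressure is all that remains.
    pressure-raises : ∀ fuel {w} → NonNeg w → 1# ≤ fromℕ fuel * ν + pressure r w →
                      1# ≤ pressure r (raises (rounds fuel r w) r w)
    pressure-raises zero {w} 0≤w le = subst (1# ≤_) (trans (cong (_+ pressure r w) (zeroˡ ν)) (+-identityˡ _)) le
    pressure-raises (suc fuel) {w} 0≤w le with pressure r w <? 1#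
    ... | no p≮1 = ≮⇒≥ p≮1
    ... | yes _ = pressure-raises fuel (raise-nonNeg 0≤w) (begin
      1#                                              ≤⟨ le ⟩
      (1# + fromℕ fuel) * ν + pressure r w            ≡⟨ solve 3 (λ k v p → (con 1 :+ k) :* v :+ p := k :* v :+ (p :+ v)) refl (fromℕ fuel) ν (pressure r w) ⟩
      fromℕ fuel * ν + (pressure r w + ν)             ≤⟨ +-monoʳ-≤ (fromℕ fuel * ν) (pressure-raise 0≤w) ⟩
      fromℕ fuel * ν + pressure r (raise r w)         ∎)

    absorb-covers : ∀ {w} → NonNeg w → 1# ≤ pressure r (absorb r w)
    absorb-covers 0≤w = pressure-raises n 0≤w
      (subst (λ x → 1# ≤ x + pressure r _) (sym n*ν≡1) (x≤x+y (pressure-nonNeg 0≤w)))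

    raises-nonNeg : ∀ k {w} → NonNeg w → NonNeg (raises k r w)
    raises-nonNeg zero 0≤w = 0≤w
    raises-nonNeg (suc k) 0≤w = raises-nonNeg k (raise-nonNeg 0≤w)

    alg-nonNeg : ∀ past → 0# ≤ alg past r
    alg-nonNeg past = *-nonNeg (fromℕ-nonNeg (rounds n r (weights past))) unit-nonNeg

    -- A positive value comprises at least one whole raise by `unit r`, and `mass r * unit r` is 1.
    alg-pos⇒1≤ : ∀ past → 0# < alg past r → 1# ≤ mass r * alg past r
    alg-pos⇒1≤ past 0<y with rounds n r (weights past)
    ... | zero = contradiction 0<y (irrefl (sym (zeroˡ (unit r))))
    ... | suc k = begin
      1#                                     ≤⟨ 1≤fromℕ-suc k ⟩
      fromℕ (suc k)                          ≡⟨ *-identityʳ _ ⟨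
      fromℕ (suc k) * 1#                     ≡⟨ cong (fromℕ (suc k) *_) mass*unit≡1 ⟨
      fromℕ (suc k) * (mass r * unit r)      ≡⟨ solve 3 (λ k m u → k :* (m :* u) := m :* (k :* u)) refl (fromℕ (suc k)) (mass r) (unit r) ⟩
      mass r * (fromℕ (suc k) * unit r)      ∎

  -- From single raises to whole runs.

  weightsAfter-nonNeg : ∀ {m} past (A : Matrix m n) → (∀ i → IsRow (lookup A i)) →
    NonNeg (weights past) → NonNeg (weightsAfter past A)
  weightsAfter-nonNeg past [] rows 0≤w = 0≤w
  weightsAfter-nonNeg past (r ∷ A) rows 0≤w =
    weightsAfter-nonNeg (r ∷ past) A (λ i → rows (suc i)) (raises-nonNeg (rows zero) (rounds n r (weights past)) 0≤w)

  -- Induction over all raises of a run. The accumulator `q` collects `g` of each row times the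
  -- value given to it, `I` relates it to the current weights, and `Q` carries what is known about
  -- each row.
  module Invariant (Q : Row → Set) (g : Row → ℝ) (I : Weights → ℝ → Set)
    (raise-I : ∀ {r w q} → IsRow r → Q r → NonNeg w → pressure r w < 1# →
               I w q → I (raise r w) (q + g r * unit r)) where

    unchanged : ∀ {r w q} → I w q → I w (q + g r * (fromℕ 0 * unit r))
    unchanged {r} {w} {q} = subst (I w) (solve 3 (λ q g u → q := q :+ g :* (con 0 :* u)) refl q (g r) (unit r))

    raises-I : ∀ fuel {r w q} → IsRow r → Q r → NonNeg w → I w q →
      I (raises (rounds fuel r w) r w) (q + g r * (fromℕ (rounds fuel r w) * unit r))
    raises-I zero row qr 0≤w Iw = unchanged Iw
    raises-I (suc fuel) {r} {w} {q} row qr 0≤w Iw with pressure r w <? 1#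
    ... | no _ = unchanged Iw
    ... | yes p<1 = subst (I _)
      (solve 4 (λ q g u k → q :+ g :* u :+ g :* (k :* u) := q :+ g :* ((con 1 :+ k) :* u)) refl q (g r) (unit r)
        (fromℕ (rounds fuel r (raise r w))))
      (raises-I fuel row qr (raise-nonNeg row 0≤w) (raise-I row qr 0≤w p<1 Iw))

    run-I : ∀ {m} past (A : Matrix m n) {q} → (∀ i → IsRow (lookup A i)) → (∀ i → Q (lookup A i)) →
      NonNeg (weights past) → I (weights past) q →
      I (weightsAfter past A) (q + sum (λ i → g (lookup A i) * lookup (runFrom alg past A) i))
    run-I past [] {q} rows qs 0≤w Iw = subst (I _) (sym (+-identityʳ q)) Iw
    run-I past (r ∷ A) {q} rows qs 0≤w Iw = subst (I _) (+-assoc q _ _)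
      (run-I (r ∷ past) A (λ i → rows (suc i)) (λ i → qs (suc i))
        (raises-nonNeg (rows zero) (rounds n r (weights past)) 0≤w)
        (raises-I n (rows zero) (qs zero) 0≤w Iw))

  -- A row is covered once it has been absorbed, and stays covered because weights never decrease.
  run-covers : ∀ {m} past (A : Matrix m n) → (∀ i → IsRow (lookup A i)) → NonNeg (weights past) →
    ∀ i → 1# ≤ pressure (lookup A i) (weightsAfter past A)
  run-covers past (r ∷ A) rows 0≤w zero =
    run-I (r ∷ past) A {0#} (λ i → rows (suc i)) (λ i → rows (suc i)) 0≤w′ (absorb-covers (rows zero) 0≤w)
    where
    0≤w′ : NonNeg (weights (r ∷ past))
    0≤w′ = raises-nonNeg (rows zero) (rounds n r (weights past)) 0≤w
    -- The accumulator is ignored: what is followed is the pressure of the earlier row `r` while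
    -- later rows raise the weights.
    open Invariant IsRow (λ _ → 0#) (λ w _ → 1# ≤ pressure r w)
      (λ row _ 0≤w _ 1≤p → ≤-trans 1≤p
        (sum-mono-≤ λ j → *-monoʳ-≤ (density-nonNeg (rows zero) j) (w≤raise row 0≤w j)))
  run-covers past (r ∷ A) rows 0≤w (suc i) =
    run-covers (r ∷ past) A (λ i → rows (suc i)) (raises-nonNeg (rows zero) (rounds n r (weights past)) 0≤w) i

  run-nonNeg : ∀ {m} past (A : Matrix m n) → (∀ i → IsRow (lookup A i)) →
    ∀ i → 0# ≤ lookup (runFrom alg past A) i
  run-nonNeg past (r ∷ A) rows zero = alg-nonNeg (rows zero) past
  run-nonNeg past (r ∷ A) rows (suc i) = run-nonNeg (r ∷ past) A (λ i → rows (suc i)) i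

  run-pos⇒1≤ : ∀ {m} past (A : Matrix m n) → (∀ i → IsRow (lookup A i)) →
    ∀ i → 0# < lookup (runFrom alg past A) i → 1# ≤ mass (lookup A i) * lookup (runFrom alg past A) i
  run-pos⇒1≤ past (r ∷ A) rows zero = alg-pos⇒1≤ (rows zero) past
  run-pos⇒1≤ past (r ∷ A) rows (suc i) = run-pos⇒1≤ (r ∷ past) A (λ i → rows (suc i)) i

  -- The relative load `L j`, that is, the load in units of `c j`.
  congestion : ∀ {m} → Matrix m n → Vec ℝ m → Fin n → ℝ
  congestion A y j = sum λ i → density (lookup A i) j * lookup y i

  load≡c*congestion : ∀ {m} (A : Matrix m n) y j → load A y j ≡ lookup c j * congestion A y j
  load≡c*congestion A y j = begin-equality
    load A y j                                                        ≡⟨ sum-cong-≗ term ⟩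
    sum (λ i → lookup c j * (density (lookup A i) j * lookup y i))    ≡⟨ *-distribˡ-sum (lookup c j) (λ i → density (lookup A i) j * lookup y i) ⟨
    lookup c j * congestion A y j                                     ∎
    where
    term : ∀ i → entry A i j * lookup y i ≡ lookup c j * (density (lookup A i) j * lookup y i)
    term i = trans (cong (_* lookup y i) (sym (x*[y/x]≡y (entry A i j) (0<c j)))) (*-assoc (lookup c j) (density (lookup A i) j) (lookup y i))

  -- Weak duality: covering lets each `y i` be multiplied by a pressure of at least 1, and
  -- exchanging the sums leaves congestions, which are at most 1 for a feasible `y`.
  total≤sum-weights : ∀ {m} (A : Matrix m n) {w} → NonNeg w → (∀ i → 1# ≤ pressure (lookup A i) w) →
    ∀ y → IsFeasible A c y → total A y ≤ sum w
  total≤sum-weights A {w} 0≤w covers y (0≤y , load≤c) = begin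
    total A y                                                         ≤⟨ sum-mono-≤ (λ i → x≤y⇒x≤zy (0≤y i) (covers i)) ⟩
    sum (λ i → pressure (lookup A i) w * lookup y i)                  ≡⟨ sum-cong-≗ (λ i → *-distribʳ-sum (lookup y i) (λ j → density (lookup A i) j * w j)) ⟩
    sum (λ i → sum (λ j → density (lookup A i) j * w j * lookup y i)) ≡⟨ ∑-comm (λ i j → density (lookup A i) j * w j * lookup y i) ⟩
    sum (λ j → sum (λ i → density (lookup A i) j * w j * lookup y i)) ≡⟨ sum-cong-≗ (λ j → sum-cong-≗ (λ i →
                                                                           solve 3 (λ b w y → b :* w :* y := w :* (b :* y)) refl (density (lookup A i) j) (w j) (lookup y i))) ⟩
    sum (λ j → sum (λ i → w j * (density (lookup A i) j * lookup y i))) ≡⟨ sum-cong-≗ (λ j → *-distribˡ-sum (w j) (λ i → density (lookup A i) j * lookup y i)) ⟨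
    sum (λ j → w j * congestion A y j)                                ≤⟨ sum-mono-≤ (λ j → *-monoʳ-≤ (0≤w j) (congestion≤1 j)) ⟩
    sum (λ j → w j * 1#)                                              ≡⟨ sum-cong-≗ (λ j → *-identityʳ (w j)) ⟩
    sum w                                                             ∎
    where
    congestion≤1 : ∀ j → congestion A y j ≤ 1#
    congestion≤1 j = *-cancelˡ-≤ (0<c j) (subst₂ _≤_ (load≡c*congestion A y j) (sym (*-identityʳ _)) (load≤c j))

  -- Bounds for the unscaled run on a fixed matrix.

  module Run {m} (A : Matrix m n) (rows : ∀ i → IsRow (lookup A i)) where

    y : Vec ℝ m
    y = run alg A

    w : Weights
    w = weightsAfter [] A

    0≤w : NonNeg w
    0≤w = weightsAfter-nonNeg [] A rows (λ _ → ≤-refl)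

    0≤y : ∀ i → 0# ≤ lookup y i
    0≤y = run-nonNeg [] A rows

    covered : ∀ i → 1# ≤ pressure (lookup A i) w
    covered = run-covers [] A rows (λ _ → ≤-refl)

    -- A raise adds `unit r` to the primal value and `unit r * (pressure r w + 1#)` to the dual
    -- value, at most twice as much since raises happen only below pressure 1.
    sum-weights≤2total : sum w ≤ total A y + total A y
    sum-weights≤2total = subst (λ q → sum w ≤ q + q)
      (trans (+-identityˡ _) (sum-cong-≗ λ i → *-identityˡ (lookup y i)))
      (run-I [] A rows rows (λ _ → ≤-refl) (inj₂ (trans (sum-const n 0#) (trans (zeroʳ _) (sym (+-identityˡ 0#))))))
      where
      raise-sum : ∀ {r w q} → IsRow r → IsRow r → NonNeg w → pressure r w < 1# → sum w ≤ q + q →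
        sum (raise r w) ≤ (q + 1# * unit r) + (q + 1# * unit r)
      raise-sum {r} {w} {q} row _ 0≤w p<1 w≤2q = begin
        sum (raise r w)                        ≡⟨ sum-raise row 0≤w ⟩
        sum w + unit r * (pressure r w + 1#)   ≤⟨ +-mono-≤ w≤2q (*-monoʳ-≤ (unit-nonNeg row) (+-monoˡ-≤ 1# (inj₁ p<1))) ⟩
        (q + q) + unit r * (1# + 1#)           ≡⟨ solve 2 (λ q u → (q :+ q) :+ u :* (con 1 :+ con 1) := (q :+ con 1 :* u) :+ (q :+ con 1 :* u)) refl q (unit r) ⟩
        (q + 1# * unit r) + (q + 1# * unit r)  ∎
      open Invariant IsRow (λ _ → 1#) (λ w q → sum w ≤ q + q) raise-sum

    -- Every raised variable has mass times value at least 1, and exchanging sums turns these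
    -- products into congestions. The vector `y′` makes room for the scaled solution.
    changes≤sum-congestion : ∀ (y′ : Vec ℝ m) → (∀ i → 0# < lookup y′ i → 0# < lookup y i) →
      fromℕ (changes y′) ≤ sum (congestion A y)
    changes≤sum-congestion y′ pos = begin
      fromℕ (changes y′)                                               ≤⟨ count≤sum y′ _ (λ i → *-nonNeg (inj₁ (mass-pos (rows i))) (0≤y i))
                                                                            (λ i 0<y′ → run-pos⇒1≤ [] A rows i (pos i 0<y′)) ⟩
      sum (λ i → mass (lookup A i) * lookup y i)                       ≡⟨ sum-cong-≗ (λ i → *-distribʳ-sum (lookup y i) (density (lookup A i))) ⟩
      sum (λ i → sum (λ j → density (lookup A i) j * lookup y i))      ≡⟨ ∑-comm (λ i j → density (lookup A i) j * lookup y i) ⟩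
      sum (congestion A y)                                             ∎

    -- `M` stands for a bound on the densities of constraint `j`: `α` when changes are counted, the
    -- maximal entry over `c j` when the load is bounded.
    module _ (j : Fin n) (M : ℝ) where

      exp-raise : ∀ {r w q} → IsRow r → 0# ≤ M → NonNeg w →
        exp (½ * q) ≤ 1# + fromℕ n * M * w j →
        exp (½ * (q + density r j * unit r)) ≤ (1# + fromℕ n * M * w j) * (1# + density r j * unit r)
      exp-raise {r} {w} {q} row 0≤M 0≤w le = begin
        exp (½ * (q + t))                        ≡⟨ cong exp (distribˡ ½ q t) ⟩
        exp (½ * q + ½ * t)                      ≡⟨ exp-+ _ _ ⟩
        exp (½ * q) * exp (½ * t)                ≤⟨ *-mono-≤ (inj₁ (0<exp _)) 0≤z le (exp-½ 0≤t (density*unit≤1 row j)) ⟩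
        (1# + fromℕ n * M * w j) * (1# + t)      ∎
        where
        t : ℝ
        t = density r j * unit r
        0≤t : 0# ≤ t
        0≤t = *-nonNeg (density-nonNeg row j) (unit-nonNeg row)
        0≤z : 0# ≤ 1# + fromℕ n * M * w j
        0≤z = +-nonNeg 0≤1 (*-nonNeg (*-nonNeg (fromℕ-nonNeg n) 0≤M) (0≤w j))

      -- In the expansion of `(1 + K * v) * (1 + b * u)`, the term `K * v * (b * u)` is `K` times
      -- the multiplicative share of the raise. The term `b * u` is at most `M * u`, which is `K`
      -- times the additive share; this is why `K = n * M`.
      exp-invariant : ∀ {r w q} → IsRow r → density r j ≤ M → 0# ≤ M → NonNeg w →
        exp (½ * q) ≤ 1# + fromℕ n * M * w j →
        exp (½ * (q + density r j * unit r)) ≤ 1# + fromℕ n * M * raise r w j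
      exp-invariant {r} {w} {q} row b≤M 0≤M 0≤w le = begin
        exp (½ * (q + b * u))                       ≤⟨ exp-raise row 0≤M 0≤w le ⟩
        (1# + K * v) * (1# + b * u)                 ≡⟨ solve 2 (λ x t → (con 1 :+ x) :* (con 1 :+ t) := (con 1 :+ (x :+ x :* t)) :+ t) refl (K * v) (b * u) ⟩
        1# + (K * v + K * v * (b * u)) + b * u      ≤⟨ +-monoʳ-≤ _ (*-monoˡ-≤ (unit-nonNeg row) b≤M) ⟩
        1# + (K * v + K * v * (b * u)) + M * u      ≡⟨ cong₂ (λ x y → 1# + (K * v + x) + y)
                                                         (solve 4 (λ k v b u → k :* v :* (b :* u) := k :* (u :* (b :* v))) refl K v b u) Mu≡ ⟩
        1# + (K * v + K * (u * (b * v))) + K * (u * ν) ≡⟨ solve 4 (λ k v x y → con 1 :+ (k :* v :+ k :* x) :+ k :* y := con 1 :+ k :* (v :+ (x :+ y))) refl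
                                                         K v (u * (b * v)) (u * ν) ⟩
        1# + K * (v + (u * (b * v) + u * ν))        ≡⟨ cong (λ x → 1# + K * (v + x)) (distribˡ u (b * v) ν) ⟨
        1# + K * raise r w j                        ∎
        where
        K b u v : ℝ
        K = fromℕ n * M
        b = density r j
        u = unit r
        v = w j
        Mu≡ : M * u ≡ K * (u * ν)
        Mu≡ = begin-equality
          M * u                    ≡⟨ *-identityˡ (M * u) ⟨
          1# * (M * u)             ≡⟨ cong (_* (M * u)) (n*ν≡1 row) ⟨
          fromℕ n * ν * (M * u)    ≡⟨ solve 4 (λ k v m u → k :* v :* (m :* u) := k :* m :* (u :* v)) refl (fromℕ n) ν M u ⟩
          K * (u * ν)              ∎

      -- A raise happens only while `b * w j ≤ 1`, so `M * w j ≤ ρ` just before it, and the raise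
      -- itself contributes a factor `1 + t` of at most 2. If `b` is not positive, the congestion
      -- does not grow and the old bound persists.
      ratio-invariant : ∀ {r w q ρ} → IsRow r → 0# ≤ M → NonNeg w → pressure r w < 1# →
        0# ≤ ρ → (0# < density r j → M ≤ ρ * density r j) →
        exp (½ * q) ≤ 1# + fromℕ n * M * w j → exp (½ * q) ≤ 2# * (1# + fromℕ n * ρ) →
        exp (½ * (q + density r j * unit r)) ≤ 2# * (1# + fromℕ n * ρ)
      ratio-invariant {r} {w} {q} {ρ} row 0≤M 0≤w p<1 0≤ρ M≤ρb le le′ = by-cases (0# <? b)
        where
        b : ℝ
        b = density r j
        bw≤1 : b * w j ≤ 1#
        bw≤1 = ≤-trans (term≤sum (pressure-terms-nonNeg row 0≤w) j) (inj₁ p<1)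
        by-cases : Dec (0# < b) → exp (½ * (q + b * unit r)) ≤ 2# * (1# + fromℕ n * ρ)
        by-cases (no 0≮b) = ≤-trans (exp-mono-≤ (*-monoʳ-≤ (inj₁ (⁻¹-pos 0<2)) q′≤q)) le′
          where
          q′≤q : q + b * unit r ≤ q
          q′≤q = begin
            q + b * unit r  ≤⟨ +-monoʳ-≤ q (*-monoˡ-≤ (unit-nonNeg row) (≮⇒≥ 0≮b)) ⟩
            q + 0# * unit r ≡⟨ trans (cong (q +_) (zeroˡ (unit r))) (+-identityʳ q) ⟩
            q               ∎
        by-cases (yes 0<b) = begin
          exp (½ * (q + b * unit r))                   ≤⟨ exp-raise row 0≤M 0≤w le ⟩
          (1# + fromℕ n * M * w j) * (1# + b * unit r) ≤⟨ *-mono-≤ 0≤1+bu 0≤1+nρ (+-monoʳ-≤ 1# nMw≤nρ) (+-monoʳ-≤ 1# (density*unit≤1 row j)) ⟩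
          (1# + fromℕ n * ρ) * 2#                      ≡⟨ *-comm (1# + fromℕ n * ρ) 2# ⟩
          2# * (1# + fromℕ n * ρ)                      ∎
          where
          0≤1+nρ : 0# ≤ 1# + fromℕ n * ρ
          0≤1+nρ = +-nonNeg 0≤1 (*-nonNeg (fromℕ-nonNeg n) 0≤ρ)
          0≤1+bu : 0# ≤ 1# + b * unit r
          0≤1+bu = +-nonNeg 0≤1 (*-nonNeg (density-nonNeg row j) (unit-nonNeg row))
          nMw≤nρ : fromℕ n * M * w j ≤ fromℕ n * ρ
          nMw≤nρ = begin
            fromℕ n * M * w j         ≡⟨ *-assoc (fromℕ n) M (w j) ⟩
            fromℕ n * (M * w j)       ≤⟨ *-monoʳ-≤ (fromℕ-nonNeg n) (*-monoˡ-≤ (0≤w j) (M≤ρb 0<b)) ⟩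
            fromℕ n * (ρ * b * w j)   ≡⟨ cong (fromℕ n *_) (*-assoc ρ b (w j)) ⟩
            fromℕ n * (ρ * (b * w j)) ≤⟨ *-monoʳ-≤ (fromℕ-nonNeg n) (*-monoʳ-≤ 0≤ρ bw≤1) ⟩
            fromℕ n * (ρ * 1#)        ≡⟨ cong (fromℕ n *_) (*-identityʳ ρ) ⟩
            fromℕ n * ρ               ∎

      module _ (0≤M : 0# ≤ M) (b≤M : ∀ i → density (lookup A i) j ≤ M) where

        exp-initial : exp (½ * 0#) ≤ 1# + fromℕ n * M * 0#
        exp-initial = inj₂ (trans (cong exp (zeroʳ ½)) (trans exp-0
          (sym (trans (cong (1# +_) (zeroʳ _)) (+-identityʳ 1#)))))

        exp-congestion≤weight : exp (½ * congestion A y j) ≤ 1# + fromℕ n * M * w j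
        exp-congestion≤weight = subst (λ q → exp (½ * q) ≤ 1# + fromℕ n * M * w j) (+-identityˡ _)
          (run-I [] A rows b≤M (λ _ → ≤-refl) exp-initial)
          where
          open Invariant (λ r → density r j ≤ M) (λ r → density r j) (λ w q → exp (½ * q) ≤ 1# + fromℕ n * M * w j)
            (λ row b≤M 0≤w _ le → exp-invariant row b≤M 0≤M 0≤w le)

        exp-congestion≤ratio : ∀ {ρ} → 0# ≤ ρ →
          (∀ i → 0# < density (lookup A i) j → M ≤ ρ * density (lookup A i) j) →
          exp (½ * congestion A y j) ≤ 2# * (1# + fromℕ n * ρ)
        exp-congestion≤ratio {ρ} 0≤ρ M≤ρb = subst (λ q → exp (½ * q) ≤ bound) (+-identityˡ _)
          (proj₂ (run-I [] A rows (λ i → b≤M i , M≤ρb i) (λ _ → ≤-refl) (exp-initial , 1≤bound)))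
          where
          bound : ℝ
          bound = 2# * (1# + fromℕ n * ρ)
          1≤bound : exp (½ * 0#) ≤ bound
          1≤bound = begin
            exp (½ * 0#)        ≡⟨ trans (cong exp (zeroʳ ½)) exp-0 ⟩
            1#                  ≤⟨ x≤x+y (*-nonNeg (fromℕ-nonNeg n) 0≤ρ) ⟩
            1# + fromℕ n * ρ    ≤⟨ x≤y⇒x≤zy (+-nonNeg 0≤1 (*-nonNeg (fromℕ-nonNeg n) 0≤ρ)) (x≤x+y 0≤1) ⟩
            bound               ∎
          open Invariant (λ r → density r j ≤ M × (0# < density r j → M ≤ ρ * density r j)) (λ r → density r j)
            -- `ratio-invariant` uses the weight bound at every raise, so both bounds are carried
            -- together.
            (λ w q → exp (½ * q) ≤ 1# + fromℕ n * M * w j × exp (½ * q) ≤ bound)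
            (λ row (b≤M , M≤ρb) 0≤w p<1 (le , le′) →
              exp-invariant row b≤M 0≤M 0≤w le , ratio-invariant row 0≤M 0≤w p<1 0≤ρ M≤ρb le le′)

    OPT≤2total : ∀ {OPT} → IsOPT A c OPT → OPT ≤ total A y + total A y
    OPT≤2total ((y* , feasible , refl) , _) = ≤-trans (total≤sum-weights A 0≤w covered y* feasible) sum-weights≤2total

    -- Dividing the solution by `V` makes it feasible, so `OPT` bounds its value.
    total≤V*OPT : ∀ {OPT V} → IsOPT A c OPT → 0# < V → (∀ j → congestion A y j ≤ V) → total A y ≤ V * OPT
    total≤V*OPT {OPT} {V} (_ , ≤OPT) 0<V L≤V = begin
      total A y               ≡⟨ x*[y/x]≡y (total A y) 0<V ⟨
      V * (total A y / V)     ≡⟨ cong (V *_) (trans (*-comm _ _) (sym (total-map-* A (V ⁻¹) y))) ⟩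
      V * total A y/V         ≤⟨ *-monoʳ-≤ (inj₁ 0<V) (≤OPT _ (y/V , (nonNeg , load≤c) , refl)) ⟩
      V * OPT                 ∎
      where
      y/V : Vec ℝ m
      y/V = Vec.map (V ⁻¹ *_) y
      0≤V⁻¹ : 0# ≤ V ⁻¹
      0≤V⁻¹ = inj₁ (⁻¹-pos 0<V)
      nonNeg : ∀ i → 0# ≤ lookup y/V i
      nonNeg i = subst (0# ≤_) (sym (lookup-map i (V ⁻¹ *_) y)) (*-nonNeg 0≤V⁻¹ (0≤y i))
      load≤c : ∀ j → load A y/V j ≤ lookup c j
      load≤c j = begin
        load A y/V j                             ≡⟨ load-map-* A (V ⁻¹) y j ⟩
        V ⁻¹ * load A y j                        ≡⟨ cong (V ⁻¹ *_) (load≡c*congestion A y j) ⟩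
        V ⁻¹ * (lookup c j * congestion A y j)   ≤⟨ *-monoʳ-≤ 0≤V⁻¹ (*-monoʳ-≤ (inj₁ (0<c j)) (L≤V j)) ⟩
        V ⁻¹ * (lookup c j * V)                  ≡⟨ solve 3 (λ i c v → i :* (c :* v) := v :* (c :* i)) refl (V ⁻¹) (lookup c j) V ⟩
        V * (lookup c j / V)                     ≡⟨ x*[y/x]≡y (lookup c j) 0<V ⟩
        lookup c j                               ∎

    congestion≤0 : ∀ {j} → (∀ i → ¬ 0# < entry A i j) → congestion A y j ≤ 0#
    congestion≤0 {j} none = begin
      congestion A y j        ≤⟨ sum-mono-≤ (λ i → *-monoˡ-≤ (0≤y i) (*-monoˡ-≤ (inj₁ (⁻¹-pos (0<c j))) (≮⇒≥ (none i)))) ⟩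
      sum {m} (λ i → 0# / lookup c j * lookup y i) ≡⟨ sum-cong-≗ (λ i → trans (cong (_* lookup y i) (zeroˡ _)) (zeroˡ _)) ⟩
      sum {m} (λ _ → 0#)      ≡⟨ trans (sum-const m 0#) (zeroʳ _) ⟩
      0#                      ∎

    module _ {j a⁺ a⁻} (max : IsMaxEntry A j a⁺) (min : IsMinPositiveEntry A j a⁻) where

      0<a⁻ : 0# < a⁻
      0<a⁻ = proj₂ (proj₁ min)

      a⁻≤a⁺ : a⁻ ≤ a⁺
      a⁻≤a⁺ = proj₂ max a⁻ (proj₁ (proj₁ min))

      0≤a⁺ : 0# ≤ a⁺
      0≤a⁺ = ≤-trans (inj₁ 0<a⁻) a⁻≤a⁺

      1≤ratio : 1# ≤ a⁺ / a⁻
      1≤ratio = subst (_≤ a⁺ / a⁻) (*-inverse-pos 0<a⁻) (*-monoˡ-≤ (inj₁ (⁻¹-pos 0<a⁻)) a⁻≤a⁺)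

      0≤ratio : 0# ≤ a⁺ / a⁻
      0≤ratio = ≤-trans 0≤1 1≤ratio

      -- The capacity cancels from the ratio of densities: `M` is `a⁺ / c j` and `ρ` is `a⁺ / a⁻`.
      exp-congestion≤entry-ratio : exp (½ * congestion A y j) ≤ 2# * (1# + fromℕ n * (a⁺ / a⁻))
      exp-congestion≤entry-ratio = exp-congestion≤ratio j (a⁺ / lookup c j) (/-nonNeg 0≤a⁺ (0<c j))
        (λ i → *-monoˡ-≤ (inj₁ 0<c⁻¹) (proj₂ max _ (i , refl))) 0≤ratio bound
        where
        0<c⁻¹ : 0# < lookup c j ⁻¹
        0<c⁻¹ = ⁻¹-pos (0<c j)
        bound : ∀ i → 0# < density (lookup A i) j → a⁺ / lookup c j ≤ a⁺ / a⁻ * density (lookup A i) j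
        bound i 0<b = begin
          a⁺ / lookup c j                        ≡⟨ cong (_/ lookup c j) (trans (sym (x*[y/x]≡y a⁺ 0<a⁻)) (*-comm _ _)) ⟩
          a⁺ / a⁻ * a⁻ / lookup c j              ≡⟨ *-assoc _ _ _ ⟩
          a⁺ / a⁻ * (a⁻ / lookup c j)            ≤⟨ *-monoʳ-≤ 0≤ratio (*-monoˡ-≤ (inj₁ 0<c⁻¹) (proj₂ min _ ((i , refl) , 0<a))) ⟩
          a⁺ / a⁻ * density (lookup A i) j       ∎
          where
          0<a : 0# < entry A i j
          0<a = *-cancelˡ-pos 0<c⁻¹ (subst (0# <_) (*-comm _ _) 0<b)

      1≤n : 1# ≤ fromℕ n
      1≤n = Fin⇒1≤fromℕ j

      1≤n*ratio : 1# ≤ fromℕ n * (a⁺ / a⁻)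
      1≤n*ratio = ≤-trans 1≤ratio (x≤y⇒x≤zy 0≤ratio 1≤n)

      -- Taking `n ⊔ 2` makes `u = exp l` at least 2, which absorbs the constants:
      -- `2 * (1 + n * ρ) ≤ 4 * u ≤ u * u * u`. Undoing the factor `½` doubles the resulting
      -- `3 * l`.
      congestion≤log : let l = ln (fromℕ (n ⊔ 2)) + ln (a⁺ / a⁻) in
        congestion A y j ≤ (l + l + l) + (l + l + l)
      congestion≤log = ½x≤y⇒x≤y+y (exp-cancel-≤ (begin
        exp (½ * congestion A y j)   ≤⟨ exp-congestion≤entry-ratio ⟩
        2# * (1# + fromℕ n * ρ)      ≤⟨ *-monoʳ-≤ 0≤2 (+-mono-≤ 1≤u nρ≤u) ⟩
        2# * (u + u)                 ≡⟨ solve 1 (λ u → con 2 :* (u :+ u) := con 2 :* con 2 :* u) refl u ⟩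
        2# * 2# * u                  ≤⟨ *-monoˡ-≤ 0≤u (*-mono-≤ 0≤2 0≤u 2≤u 2≤u) ⟩
        u * u * u                    ≡⟨ cong (λ x → x * x * x) exp-l ⟨
        exp l * exp l * exp l        ≡⟨ cong (_* exp l) (exp-+ l l) ⟨
        exp (l + l) * exp l          ≡⟨ exp-+ (l + l) l ⟨
        exp (l + l + l)              ∎))
        where
        N ρ l u : ℝ
        N = fromℕ (n ⊔ 2)
        ρ = a⁺ / a⁻
        l = ln N + ln ρ
        u = N * ρ
        2≤N : 2# ≤ N
        2≤N = subst (_≤ N) fromℕ-2 (fromℕ-mono-≤ (m≤n⊔m n 2))
        0<N : 0# < N
        0<N = begin-strict 0# <⟨ 0<2 ⟩ 2# ≤⟨ 2≤N ⟩ N ∎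
        0<ρ : 0# < ρ
        0<ρ = begin-strict 0# <⟨ 0<1 ⟩ 1# ≤⟨ 1≤ratio ⟩ ρ ∎
        exp-l : exp l ≡ u
        exp-l = trans (exp-+ _ _) (cong₂ _*_ (exp-ln 0<N) (exp-ln 0<ρ))
        2≤u : 2# ≤ u
        2≤u = ≤-trans 2≤N (subst (_≤ u) (*-identityʳ N) (*-monoʳ-≤ (inj₁ 0<N) 1≤ratio))
        0≤u : 0# ≤ u
        0≤u = ≤-trans 0≤2 2≤u
        1≤u : 1# ≤ u
        1≤u = ≤-trans (x≤x+y 0≤1) 2≤u
        nρ≤u : fromℕ n * ρ ≤ u
        nρ≤u = *-monoˡ-≤ 0≤ratio (fromℕ-mono-≤ (m≤m⊔n n 2))

      -- The argument of the logarithm that constraint `j` contributes to `B′`.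
      z : ℝ
      z = fromℕ 2 * fromℕ n * a⁺ / a⁻ + 1#

      z≡ : z ≡ 2# * (fromℕ n * (a⁺ / a⁻)) + 1#
      z≡ = trans (cong (λ two → two * fromℕ n * a⁺ / a⁻ + 1#) fromℕ-2)
        (solve 3 (λ n a b → con 2 :* n :* a :* b :+ con 1 := con 2 :* (n :* (a :* b)) :+ con 1) refl (fromℕ n) a⁺ (a⁻ ⁻¹))

      2≤z : 2# ≤ z
      2≤z = begin
        2#                                     ≡⟨ *-identityʳ 2# ⟨
        2# * 1#                                ≤⟨ *-monoʳ-≤ 0≤2 1≤n*ratio ⟩
        2# * (fromℕ n * (a⁺ / a⁻))             ≤⟨ x≤x+y 0≤1 ⟩
        2# * (fromℕ n * (a⁺ / a⁻)) + 1#        ≡⟨ z≡ ⟨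
        z                                      ∎

      exp-ln-z : exp (ln z) ≡ z
      exp-ln-z = exp-ln (begin-strict 0# <⟨ 0<2 ⟩ 2# ≤⟨ 2≤z ⟩ z ∎)

      ln-z-pos : 0# < ln z
      ln-z-pos with 0# <? ln z
      ... | yes 0<ln = 0<ln
      ... | no 0≮ln = contradiction (exp-mono-≤ (≮⇒≥ 0≮ln)) (<⇒≱ (begin-strict
        exp 0#     ≡⟨ exp-0 ⟩
        1#         ≡⟨ +-identityʳ 1# ⟨
        1# + 0#    <⟨ +-monoʳ-< 1# 0<1 ⟩
        2#         ≤⟨ 2≤z ⟩
        z          ≡⟨ exp-ln-z ⟨
        exp (ln z) ∎))

      -- Here `2 * (1 + n * ρ)` is exactly `z + 1`, and `2 ≤ z` gives `z + 1 ≤ 2 * z ≤ z * z`.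
      ½congestion≤2ln-z : ½ * congestion A y j ≤ ln z + ln z
      ½congestion≤2ln-z = exp-cancel-≤ (begin
        exp (½ * congestion A y j)              ≤⟨ exp-congestion≤entry-ratio ⟩
        2# * (1# + fromℕ n * (a⁺ / a⁻))         ≡⟨ solve 1 (λ x → con 2 :* (con 1 :+ x) := (con 2 :* x :+ con 1) :+ con 1) refl (fromℕ n * (a⁺ / a⁻)) ⟩
        2# * (fromℕ n * (a⁺ / a⁻)) + 1# + 1#    ≡⟨ cong (_+ 1#) z≡ ⟨
        z + 1#                                  ≤⟨ +-monoʳ-≤ z (≤-trans (x≤x+y 0≤1) 2≤z) ⟩
        z + z                                   ≡⟨ solve 1 (λ z → z :+ z := con 2 :* z) refl z ⟩
        2# * z                                  ≤⟨ *-monoˡ-≤ (≤-trans 0≤2 2≤z) 2≤z ⟩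
        z * z                                   ≡⟨ cong₂ _*_ exp-ln-z exp-ln-z ⟨
        exp (ln z) * exp (ln z)                 ≡⟨ exp-+ (ln z) (ln z) ⟨
        exp (ln z + ln z)                       ∎)

    -- The number of changes in terms of `B′`, `OPT` and `α`.

    module _ {B′} (isB′ : IsB′ A B′) where

      v : ℝ
      v = proj₁ isB′

      B′≡ : B′ ≡ v + v + v
      B′≡ = trans (proj₂ (proj₂ isB′)) (trans (cong (_* v) fromℕ-3)
        (solve 1 (λ v → (con 1 :+ con 2) :* v := v :+ v :+ v) refl v))

      -- A value of `B′` presupposes a constraint with entries, hence a row, and then maximal
      -- entries exist.
      some-index : Fin m
      some-index with proj₁ (proj₁ (proj₂ isB′))
      ... | _ , _ , _ , ((i , _) , _) , _ = i

      v-pos : 0# < v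
      v-pos with proj₁ (proj₁ (proj₂ isB′))
      ... | _ , _ , _ , max , min , v≡ = subst (0# <_) (sym v≡) (ln-z-pos max min)

      2v≤B′ : v + v ≤ B′
      2v≤B′ = subst (v + v ≤_) (sym B′≡) (x≤x+y (inj₁ v-pos))

      B′-pos : 0# < B′
      B′-pos = begin-strict 0# <⟨ v-pos ⟩ v ≤⟨ x≤x+y (inj₁ v-pos) ⟩ v + v ≤⟨ 2v≤B′ ⟩ B′ ∎

      -- Each `ln z` is at most the maximum `v`, and `B′` is `3 * v`. A constraint without positive
      -- entries is outside that maximum but carries no load.
      congestion≤2B′ : ∀ j → congestion A y j ≤ B′ + B′
      congestion≤2B′ j with maxEntry A some-index j | minPositiveEntry A j
      ... | _ | inj₁ none = ≤-trans (congestion≤0 none) (+-nonNeg (inj₁ B′-pos) (inj₁ B′-pos))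
      ... | a⁺ , max | inj₂ (a⁻ , min) = ½x≤y⇒x≤y+y (begin
        ½ * congestion A y j     ≤⟨ ½congestion≤2ln-z max min ⟩
        ln (z max min) + ln (z max min) ≤⟨ +-mono-≤ ln≤v ln≤v ⟩
        v + v                    ≤⟨ 2v≤B′ ⟩
        B′                       ∎)
        where
        ln≤v : ln (z max min) ≤ v
        ln≤v = proj₂ (proj₁ (proj₂ isB′)) _ (j , a⁺ , a⁻ , max , min , refl)

      module _ {OPT α} (isOPT : IsOPT A c OPT) (isAlpha : IsAlpha A c α) where

        density≤α : ∀ i j → density (lookup A i) j ≤ α
        density≤α i j with maxEntry A i j
        ... | a⁺ , max = ≤-trans (*-monoˡ-≤ (inj₁ (⁻¹-pos (0<c j))) (proj₂ max _ (i , refl)))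
          (proj₂ isAlpha _ (j , a⁺ , max , refl))

        α-pos : 0# < α
        α-pos with rows some-index
        ... | isRow _ (j , 0<a) = begin-strict
          0#                              <⟨ /-pos 0<a (0<c j) ⟩
          density (lookup A some-index) j ≤⟨ density≤α some-index j ⟩
          α                               ∎

        -- For positive `OPT`, `exp s` is `B′ * OPT * α`. `X` is a polynomial in `n` and the
        -- logarithms that dominates the logarithm of `1 + 4 * n * B′ * OPT * α`.
        s X : ℝ
        s = ln B′ + ln OPT + ln α
        X = (2# + 2#) * fromℕ n + (1# + (s * s + 1#))

        0≤4n : 0# ≤ (2# + 2#) * fromℕ n
        0≤4n = *-nonNeg (+-nonNeg 0≤2 0≤2) (fromℕ-nonNeg n)

        -- Squaring s keeps the bound valid when the logarithms are negative.
        1+exp≤exp : 1# + exp s ≤ exp (1# + (s * s + 1#))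
        1+exp≤exp = begin
          1# + exp s                  ≤⟨ +-mono-≤ (1≤exp (≤-trans (square-nonNeg s) (x≤x+y 0≤1))) (exp-mono-≤ (x≤x²+1 s)) ⟩
          e + e                       ≡⟨ solve 1 (λ e → e :+ e := con 2 :* e) refl e ⟩
          2# * e                      ≤⟨ *-monoˡ-≤ (inj₁ (0<exp _)) (1+x≤exp 1#) ⟩
          exp 1# * e                  ≡⟨ exp-+ 1# (s * s + 1#) ⟨
          exp (1# + (s * s + 1#))     ∎
          where
          e : ℝ
          e = exp (s * s + 1#)

        -- By `1 + k * u ≤ (1 + k) * (1 + u)` the two factors are bounded separately, and
        -- `k = 4 * n` enters the exponent linearly.
        exp-X≥ : ∀ {u} → 0# ≤ u → 1# + u ≤ exp (1# + (s * s + 1#)) → 1# + (2# + 2#) * fromℕ n * u ≤ exp X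
        exp-X≥ {u} 0≤u le = begin
          1# + k * u                  ≤⟨ x≤x+y (+-nonNeg 0≤4n 0≤u) ⟩
          (1# + k * u) + (k + u)      ≡⟨ solve 2 (λ k u → (con 1 :+ k :* u) :+ (k :+ u) := (con 1 :+ k) :* (con 1 :+ u)) refl k u ⟩
          (1# + k) * (1# + u)         ≤⟨ *-mono-≤ (+-nonNeg 0≤1 0≤u) (inj₁ (0<exp k)) (1+x≤exp k) le ⟩
          exp k * exp (1# + (s * s + 1#)) ≡⟨ exp-+ k _ ⟨
          exp X                       ∎
          where
          k : ℝ
          k = (2# + 2#) * fromℕ n

        opt-bound : 1# + (2# + 2#) * fromℕ n * (B′ * OPT * α) ≤ exp X
        opt-bound with 0# <? OPT
        ... | yes 0<OPT = exp-X≥ (subst (0# ≤_) exp-s (inj₁ (0<exp s))) (subst (λ u → 1# + u ≤ exp (1# + (s * s + 1#))) exp-s 1+exp≤exp)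
          where
          exp-s : exp s ≡ B′ * OPT * α
          exp-s = trans (exp-+ _ _) (cong₂ _*_ (trans (exp-+ _ _) (cong₂ _*_ (exp-ln B′-pos) (exp-ln 0<OPT))) (exp-ln α-pos))
        -- `ln OPT` is unspecified here, but `1+exp≤exp` holds for every `s`, so `exp X` is still at
        -- least 1, while the product is at most 0.
        ... | no 0≮OPT = ≤-trans (+-monoʳ-≤ 1# (*-monoʳ-≤ 0≤4n u≤0))
          (exp-X≥ ≤-refl (subst (_≤ exp (1# + (s * s + 1#))) (sym (+-identityʳ 1#)) (≤-trans (x≤x+y (inj₁ (0<exp s))) 1+exp≤exp)))
          where
          u≤0 : B′ * OPT * α ≤ 0#
          u≤0 = begin
            B′ * OPT * α  ≤⟨ *-monoˡ-≤ (inj₁ α-pos) (*-monoʳ-≤ (inj₁ B′-pos) (≮⇒≥ 0≮OPT)) ⟩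
            B′ * 0# * α   ≡⟨ trans (cong (_* α) (zeroʳ B′)) (zeroˡ α) ⟩
            0#            ∎

        -- The weight `w j` is at most `sum w`, hence at most twice the total, and the total is at
        -- most `2 * B′ * OPT`; the two doublings give the 4 in `X`.
        congestion≤2X : ∀ j → congestion A y j ≤ X + X
        congestion≤2X j = ½x≤y⇒x≤y+y (exp-cancel-≤ (begin
          exp (½ * congestion A y j)             ≤⟨ exp-congestion≤weight j α (inj₁ α-pos) (λ i → density≤α i j) ⟩
          1# + fromℕ n * α * w j                 ≤⟨ +-monoʳ-≤ 1# (*-monoʳ-≤ (*-nonNeg (fromℕ-nonNeg n) (inj₁ α-pos)) w≤) ⟩
          1# + fromℕ n * α * (V * OPT + V * OPT) ≡⟨ solve 4 (λ n a b o → con 1 :+ n :* a :* ((b :+ b) :* o :+ (b :+ b) :* o)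
                                                      := con 1 :+ (con 2 :+ con 2) :* n :* (b :* o :* a)) refl (fromℕ n) α B′ OPT ⟩
          1# + (2# + 2#) * fromℕ n * (B′ * OPT * α) ≤⟨ opt-bound ⟩
          exp X                                  ∎))
          where
          V : ℝ
          V = B′ + B′
          Y≤V*OPT : total A y ≤ V * OPT
          Y≤V*OPT = total≤V*OPT isOPT (begin-strict 0# <⟨ B′-pos ⟩ B′ ≤⟨ x≤x+y (inj₁ B′-pos) ⟩ V ∎) congestion≤2B′
          w≤ : w j ≤ V * OPT + V * OPT
          w≤ = ≤-trans (term≤sum 0≤w j) (≤-trans sum-weights≤2total (+-mono-≤ Y≤V*OPT Y≤V*OPT))

        sum-congestion≤ : sum (congestion A y) ≤ fromℕ n * (X + X)
        sum-congestion≤ = ≤-trans (sum-mono-≤ congestion≤2X) (inj₂ (sum-const n (X + X)))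

theoremD1 : (R : Reals) → let open Reals R in let open Packing R in
    Σ ℝ λ C → Σ (Polynomial 4) λ P →
    (n : ℕ) (c : Vec ℝ n) → (∀ j → 0# < lookup c j) →
    (B : ℝ) → 0# < B →
    Σ (OnlineAlgorithm n) λ alg →
    (m : ℕ) (A : Matrix m n) → IsPackingMatrix A →
    (∀ i → 0# ≤ lookup (run alg A) i)
    × (∀ OPT → IsOPT A c OPT → OPT / B ≤ total A (run alg A))
    × (∀ B′ OPT α → IsB′ A B′ → IsOPT A c OPT → IsAlpha A c α →
    fromℕ (changes (run alg A)) ≤ evaluate P (fromℕ n ∷ ln B′ ∷ ln OPT ∷ ln α ∷ []))
    × (∀ (j : Fin n) aᵐᵃˣ aᵐⁱⁿ → IsMaxEntry A j aᵐᵃˣ → IsMinPositiveEntry A j aᵐⁱⁿ →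
    load A (run alg A) j
    ≤ lookup c j * (C * ((ln (fromℕ (n ⊔ 2)) + ln (aᵐᵃˣ / aᵐⁱⁿ)) / B)))
-- The unscaled total is at least `OPT / 2`, so the factor `2 / B` makes it at least `OPT / B`.
theoremD1 R = C , P , λ n c 0<c B 0<B →
  (λ past r → 2# / B * MultiplicativeWeights.alg R n c 0<c past r) ,
  λ m A (0≤A , 0<A) → scaled n c 0<c B 0<B m A (λ i → MultiplicativeWeights.isRow (0≤A i) (0<A i))
  where
  open Reals R
  open Packing R
  open RealProperties R
  open PackingProperties R

  -- The constant is 12: a factor 2 from the scaling and 6 from `congestion≤log`.
  C : ℝ
  C = 2# * (2# * (1# + 2#))

  -- The variables are, in order, `n`, `ln B′`, `ln OPT` and `ln α`; evaluating `P` computes to the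
  -- bound of `sum-congestion≤`.
  S X P : Polynomial 4
  S = Ι (suc zero) ⊕ Ι (suc (suc zero)) ⊕ Ι (suc (suc (suc zero)))
  X = (Κ 2# ⊕ Κ 2#) ⊗ Ι zero ⊕ (Κ 1# ⊕ (S ⊗ S ⊕ Κ 1#))
  P = Ι zero ⊗ (X ⊕ X)

  scaled : ∀ n c 0<c B (0<B : 0# < B) m (A : Matrix m n) →
    let open MultiplicativeWeights R n c 0<c using (alg; IsRow)
        y = run (λ past r → 2# / B * alg past r) A in
    (∀ i → IsRow (lookup A i)) →
    (∀ i → 0# ≤ lookup y i)
    × (∀ OPT → IsOPT A c OPT → OPT / B ≤ total A y)
    × (∀ B′ OPT α → IsB′ A B′ → IsOPT A c OPT → IsAlpha A c α →
       fromℕ (changes y) ≤ evaluate P (fromℕ n ∷ ln B′ ∷ ln OPT ∷ ln α ∷ []))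
    × (∀ j a⁺ a⁻ → IsMaxEntry A j a⁺ → IsMinPositiveEntry A j a⁻ →
       load A y j ≤ lookup c j * (C * ((ln (fromℕ (n ⊔ 2)) + ln (a⁺ / a⁻)) / B)))
  scaled n c 0<c B 0<B m A rows = nonNeg , competitive , fewChanges , violation
    where
    module MW = MultiplicativeWeights R n c 0<c
    open MW.Run A rows renaming (y to ỹ; 0≤y to 0≤ỹ) using
      (OPT≤2total; changes≤sum-congestion; sum-congestion≤; congestion≤log)
    σ : ℝ
    σ = 2# / B
    0<σ : 0# < σ
    0<σ = /-pos 0<2 0<B
    y : Vec ℝ m
    y = run (λ past r → σ * MW.alg past r) A
    y≡ : y ≡ Vec.map (σ *_) ỹ
    y≡ = run-map-* σ MW.alg [] A
    lookup-y : ∀ i → lookup y i ≡ σ * lookup ỹ i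
    lookup-y i = trans (cong (λ y → lookup y i) y≡) (lookup-map i (σ *_) ỹ)
    nonNeg : ∀ i → 0# ≤ lookup y i
    nonNeg i = subst (0# ≤_) (sym (lookup-y i)) (*-nonNeg (inj₁ 0<σ) (0≤ỹ i))
    competitive : ∀ OPT → IsOPT A c OPT → OPT / B ≤ total A y
    competitive OPT isOPT = begin
      OPT / B                       ≤⟨ *-monoˡ-≤ (inj₁ (⁻¹-pos 0<B)) (OPT≤2total isOPT) ⟩
      (total A ỹ + total A ỹ) / B   ≡⟨ solve 2 (λ t i → (t :+ t) :* i := con 2 :* i :* t) refl (total A ỹ) (B ⁻¹) ⟩
      σ * total A ỹ                 ≡⟨ total-map-* A σ ỹ ⟨
      total A (Vec.map (σ *_) ỹ)    ≡⟨ cong (total A) y≡ ⟨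
      total A y                     ∎
    fewChanges : ∀ B′ OPT α → IsB′ A B′ → IsOPT A c OPT → IsAlpha A c α →
      fromℕ (changes y) ≤ evaluate P (fromℕ n ∷ ln B′ ∷ ln OPT ∷ ln α ∷ [])
    -- Scaling by the positive `σ` creates no new positive values, so the bound for the unscaled run
    -- applies.
    fewChanges B′ OPT α isB′ isOPT isAlpha = ≤-trans
      (changes≤sum-congestion y λ i 0<y → *-cancelˡ-pos 0<σ (subst (0# <_) (lookup-y i) 0<y))
      (sum-congestion≤ isB′ isOPT isAlpha)
    violation : ∀ j a⁺ a⁻ → IsMaxEntry A j a⁺ → IsMinPositiveEntry A j a⁻ →
      load A y j ≤ lookup c j * (C * ((ln (fromℕ (n ⊔ 2)) + ln (a⁺ / a⁻)) / B))
    violation j a⁺ a⁻ max min = begin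
      load A y j                                           ≡⟨ cong (λ y → load A y j) y≡ ⟩
      load A (Vec.map (σ *_) ỹ) j                          ≡⟨ load-map-* A σ ỹ j ⟩
      σ * load A ỹ j                                       ≡⟨ cong (σ *_) (MW.load≡c*congestion A ỹ j) ⟩
      σ * (lookup c j * MW.congestion A ỹ j)               ≤⟨ *-monoʳ-≤ (inj₁ 0<σ) (*-monoʳ-≤ (inj₁ (0<c j)) (congestion≤log max min)) ⟩
      σ * (lookup c j * ((l + l + l) + (l + l + l)))       ≡⟨ solve 3 (λ i c l → con 2 :* i :* (c :* ((l :+ l :+ l) :+ (l :+ l :+ l)))
                                                                := c :* (con 2 :* (con 2 :* (con 1 :+ con 2)) :* (l :* i))) refl (B ⁻¹) (lookup c j) l ⟩
      lookup c j * (C * (l / B))                           ∎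
      where
      l : ℝ
      l = ln (fromℕ (n ⊔ 2)) + ln (a⁺ / a⁻)
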